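{- Let $G$ be a finite simple connected graph other than $K_2$ and let $U$ be a set of leaves of $G$. Then there exists a set $V$ of leaves of $\rho\circ\lambda(G)$ such that \[ \rho\circ\lambda\circ\rho\circ\lambda_U(G)=\rho\circ\lambda_V\circ\rho\circ\lambda(G). \]
   Context: A leaf is a vertex of degree one; two distinct vertices are siblings if they have the same closed neighborhood $N[v]=\{v\}\cup N(v)$. For a graph $G$ other than $K_2$ and a set $S$ of leaves of $G$, $\lambda_S(G)$ is the graph obtained by removing the vertices in $S$; $\lambda(G)$ denotes the graph obtained by removing all leaves of $G$. $\rho(G)$ is the graph obtained from $G$ by contracting each maximal group of siblings to a single vertex (adjacent to the common outside neighbors of the group). Equalities of graphs are understood up to the natural identification of vertices (i.e. as isomorphic graphs). -}

module Defs where

open import Data.Empty using (⊥-elim)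
open import Data.Fin using (Fin)
import Data.Fin.Properties as Fin
open import Data.List using (List; length; filter; deduplicate; allFin)
open import Data.List.Membership.Propositional.Properties using (∈-allFin)
import Data.List.Membership.Setoid.Properties as Membership
open import Data.List.Properties using (filter-≐)
open import Data.List.Relation.Unary.All as All using (All; []; _∷_)
open import Data.List.Relation.Unary.All.Properties using (all-filter)
open import Data.List.Relation.Unary.Any as Any using (Any; here; there)
open import Data.List.Relation.Unary.Enumerates.Setoid using (IsEnumeration)
open import Data.Nat as ℕ using (ℕ)
open import Data.Product using (∃; _×_; _,_; proj₁; proj₂)
open import Data.Sum using (inj₁; inj₂)
open import Function using (_∘_; _on_)
open import Function.Bundles using (Inverse; _⇔_)
open import Level using (0ℓ)
open import Relation.Binary using (DecSetoid; Decidable; Irreflexive; IsEquivalence; Rel; Symmetric; _Respects_; _Respects₂_)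
open import Relation.Binary.Construct.Closure.ReflexiveTransitive using (Star)
open import Relation.Binary.Construct.Union using () renaming (_∪_ to _∪₂_)
import Relation.Binary.Construct.On as On
open import Relation.Binary.PropositionalEquality using (_≡_; _≢_; refl; sym; trans; cong; resp₂)
open import Relation.Nullary using (¬_; Dec; ¬?)
open import Relation.Nullary.Decidable using (map′; _×-dec_; _⊎-dec_; _→-dec_)
open import Relation.Unary as U using (Pred; _≐_; _⊆_)
open import Relation.Unary.Relation.Binary.Equality using (≐-isEquivalence)

-- Finite simple graphs.  The vertices form a setoid, so that vertices can be
-- identified by changing the equality.  The list `vertices` contains every
-- vertex up to _≈_, possibly with repetitions.
record Graph : Set₁ where
  field
    vertexSetoid : DecSetoid 0ℓ 0ℓ

  open DecSetoid vertexSetoid public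
    using (setoid; _≈_)
    renaming (Carrier to Vertex; _≟_ to _≈?_; refl to ≈-refl; sym to ≈-sym; trans to ≈-trans)

  field
    Adj         : Rel Vertex 0ℓ
    adj?        : Decidable Adj
    adj-resp-≈  : Adj Respects₂ _≈_
    adj-sym     : Symmetric Adj
    adj-irrefl  : Irreflexive _≈_ Adj
    vertices    : List Vertex
    enumeration : IsEnumeration setoid vertices

  degree : Vertex → ℕ
  degree v = length (deduplicate _≈?_ (filter (adj? v) vertices))

  Leaf : Pred Vertex 0ℓ
  Leaf v = degree v ≡ 1

  N[_] : Vertex → Pred Vertex 0ℓ
  N[ v ] = (_≈ v) U.∪ Adj v

  -- Distinct related vertices are siblings, so the equivalence classes are the
  -- maximal groups of siblings, together with a singleton for each vertex
  -- that has no sibling.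
  _≈ₛ_ : Rel Vertex 0ℓ
  u ≈ₛ v = N[ u ] ≐ N[ v ]

-- Steps along _≈_ are allowed because a vertex may have several representatives.
Connected : Graph → Set
Connected G = Vertex × (∀ u v → Star (_≈_ ∪₂ Adj) u v)
  where open Graph G

record _≅_ (G H : Graph) : Set where
  private
    module G = Graph G
    module H = Graph H
  field
    vertexInverse : Inverse G.setoid H.setoid
  open Inverse vertexInverse using (to)
  field
    adj-⇔ : ∀ u v → G.Adj u v ⇔ H.Adj (to u) (to v)

K : ℕ → Graph
K n = record
  { vertexSetoid = Fin.≡-decSetoid n
  ; Adj          = _≢_
  ; adj?         = λ u v → ¬? (u Fin.≟ v)
  ; adj-resp-≈   = resp₂ _≢_
  ; adj-sym      = λ u≢v → u≢v ∘ sym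
  ; adj-irrefl   = λ u≡v u≢v → u≢v u≡v
  ; vertices     = allFin n
  ; enumeration  = ∈-allFin
  }

record LeafSet (G : Graph) : Set₁ where
  open Graph G
  field
    Member      : Pred Vertex 0ℓ
    member?     : U.Decidable Member
    member-resp : Member Respects _≈_
    member⇒leaf : Member ⊆ Leaf

module _ (G : Graph) where
  open Graph G

  degree-cong : ∀ {u v} → u ≈ v → degree u ≡ degree v
  degree-cong {u} {v} u≈v =
    cong (length ∘ deduplicate _≈?_)
         (filter-≐ (adj? u) (adj? v)
           (proj₂ adj-resp-≈ u≈v , proj₂ adj-resp-≈ (≈-sym u≈v))
           vertices)

  allLeaves : LeafSet G
  allLeaves = record
    { Member      = Leaf
    ; member?     = λ v → degree v ℕ.≟ 1
    ; member-resp = λ u≈v d → trans (sym (degree-cong u≈v)) d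
    ; member⇒leaf = λ d → d
    }

  private
    ∈-toList : ∀ {P : Pred Vertex 0ℓ} {x xs} → Any (x ≈_) xs → (pxs : All P xs) →
               Any (λ y → x ≈ proj₁ y) (All.toList pxs)
    ∈-toList (here x≈y) (_ ∷ _)    = here x≈y
    ∈-toList (there x∈) (_ ∷ pxs) = there (∈-toList x∈ pxs)

  -- Defined for every graph; on K 2, where λ is usually left undefined,
  -- λ-all returns the empty graph.
  λ-set : LeafSet G → Graph
  λ-set S = record
    { vertexSetoid = record
        { Carrier          = ∃ Kept
        ; _≈_              = _≈_ on proj₁
        ; isDecEquivalence = On.isDecEquivalence proj₁ (DecSetoid.isDecEquivalence vertexSetoid)
        }
    ; Adj          = Adj on proj₁
    ; adj?         = λ u v → adj? (proj₁ u) (proj₁ v)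
    ; adj-resp-≈   = proj₁ adj-resp-≈ , proj₂ adj-resp-≈
    ; adj-sym      = adj-sym
    ; adj-irrefl   = adj-irrefl
    ; vertices     = All.toList (all-filter kept? vertices)
    ; enumeration  = λ (v , k) →
        ∈-toList (Membership.∈-filter⁺ setoid kept? kept-resp (enumeration v) k)
                 (all-filter kept? vertices)
    }
    where
    open LeafSet S
    Kept : Pred Vertex 0ℓ
    Kept v = ¬ Member v
    kept? : U.Decidable Kept
    kept? v = ¬? (member? v)
    kept-resp : Kept Respects _≈_
    kept-resp u≈v k m = k (member-resp (≈-sym u≈v) m)

  λ-all : Graph
  λ-all = λ-set allLeaves

  private
    N-resp : ∀ v → N[ v ] Respects _≈_
    N-resp v x≈y (inj₁ x≈v) = inj₁ (≈-trans (≈-sym x≈y) x≈v)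
    N-resp v x≈y (inj₂ v~x) = inj₂ (proj₁ adj-resp-≈ x≈y v~x)

    ∈N? : ∀ v → U.Decidable N[ v ]
    ∈N? v w = (w ≈? v) ⊎-dec adj? v w

    ⊆N? : ∀ u v → Dec (N[ u ] ⊆ N[ v ])
    ⊆N? u v = map′ to (λ u⊆v → All.tabulate (λ _ → u⊆v))
                   (All.all? (λ w → ∈N? u w →-dec ∈N? v w) vertices)
      where
      to : All (λ w → N[ u ] w → N[ v ] w) vertices → N[ u ] ⊆ N[ v ]
      to all {w} w∈Nu with All.lookupAny all (enumeration w)
      ... | f , w≈x = N-resp v (≈-sym w≈x) (f (N-resp u w≈x w∈Nu))

  _≈ₛ?_ : Decidable _≈ₛ_
  u ≈ₛ? v = ⊆N? u v ×-dec ⊆N? v u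

  ≈⇒≈ₛ : ∀ {u v} → u ≈ v → u ≈ₛ v
  ≈⇒≈ₛ u≈v = half u≈v , half (≈-sym u≈v)
    where
    half : ∀ {u v} → u ≈ v → N[ u ] ⊆ N[ v ]
    half u≈v (inj₁ w≈u) = inj₁ (≈-trans w≈u u≈v)
    half u≈v (inj₂ u~w) = inj₂ (proj₂ adj-resp-≈ u≈v u~w)

  -- The quotient of G by _≈ₛ_: a vertex stands for its class.  Since members of
  -- a class have the same closed neighbourhood, adjacency to a vertex outside
  -- the class does not depend on the chosen member.
  ρ : Graph
  ρ = record
    { vertexSetoid = record
        { Carrier          = Vertex
        ; _≈_              = _≈ₛ_
        ; isDecEquivalence = record { isEquivalence = ≈ₛ-isEquivalence ; _≟_ = _≈ₛ?_ }
        }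
    ; Adj          = Adjₛ
    ; adj?         = λ u v → adj? u v ×-dec ¬? (u ≈ₛ? v)
    ; adj-resp-≈   = respʳ , λ u≈u′ → swapₛ ∘ respʳ u≈u′ ∘ swapₛ
    ; adj-sym      = swapₛ
    ; adj-irrefl   = λ u≈v (_ , u≉v) → u≉v u≈v
    ; vertices     = vertices
    ; enumeration  = λ v → Any.map ≈⇒≈ₛ (enumeration v)
    }
    where
    ≈ₛ-isEquivalence : IsEquivalence _≈ₛ_
    ≈ₛ-isEquivalence = On.isEquivalence N[_] ≐-isEquivalence
    open IsEquivalence ≈ₛ-isEquivalence using () renaming (sym to ≈ₛ-sym; trans to ≈ₛ-trans)

    Adjₛ : Rel Vertex 0ℓ
    Adjₛ u v = Adj u v × ¬ (u ≈ₛ v)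

    swapₛ : Symmetric Adjₛ
    swapₛ {u} {v} (u~v , u≉v) = adj-sym u~v , λ v≈u → u≉v (≈ₛ-sym {v} {u} v≈u)

    respʳ : ∀ {u v v′} → v ≈ₛ v′ → Adjₛ u v → Adjₛ u v′
    respʳ {u} {v} {v′} v≈v′ (u~v , u≉v) with proj₁ v≈v′ (inj₂ (adj-sym u~v))
    ... | inj₁ u≈v′ = ⊥-elim (u≉v (≈ₛ-trans {u} {v′} {v} (≈⇒≈ₛ u≈v′) (≈ₛ-sym {v} {v′} v≈v′)))
    ... | inj₂ v′~u = adj-sym v′~u ,
                      λ u≈v′ → u≉v (≈ₛ-trans {u} {v′} {v} u≈v′ (≈ₛ-sym {v} {v′} v≈v′))

{-# OPTIONS --safe #-}

-- The relation u ∈ N[v] is the same in G, in ρ(G) and, by restriction, in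
-- λ_S(G).  So a map A → B which preserves and reflects it, and which meets every
-- sibling class of B, induces ρ(A) ≅ ρ(B).
--
-- Put H = λ_U(G).  Take for V the set of sibling classes of λ(G) none of whose
-- members survives, i.e. is a non-leaf of ρ(H).  Such a class is a leaf of
-- ρ∘λ(G): none of its members is attached to a leaf in H, so they are siblings
-- in H as well, and the only neighbour class in ρ(H) is the only one in ρ∘λ(G).
-- The map λ∘ρ(H) → λ_V∘ρ∘λ(G) fixes the vertices of λ(G); a leaf of G which is
-- not a leaf of ρ(H) is a sibling in H of its neighbour, and is sent to it.  The
-- neighbour is not a leaf of G, since G is connected and not K₂.
module Submission where

open import Defs
open import Data.Empty using (⊥-elim)
open import Data.Fin using (Fin; zero; suc)
open import Data.List using (List; []; _∷_; length; filter; deduplicate)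
import Data.List.Membership.Setoid.Properties as Membership
open import Data.List.Relation.Unary.All using (_∷_)
open import Data.List.Relation.Unary.AllPairs using (_∷_)
open import Data.List.Relation.Unary.Any as Any using (Any; here; there)
open import Data.List.Relation.Unary.Unique.DecSetoid.Properties using (deduplicate-!)
import Data.List.Relation.Unary.Unique.DecSetoid as Unique
import Data.Nat as ℕ
open import Data.Product using (Σ; ∃; _×_; _,_; proj₁; proj₂)
open import Data.Sum using (_⊎_; inj₁; inj₂; [_,_]′)
open import Function using (_∘_)
open import Function.Bundles using (_⇔_; mk⇔; module Equivalence)
open import Level using (0ℓ)
open import Relation.Binary using (DecSetoid; _Respects_)
open import Relation.Binary.Construct.Closure.ReflexiveTransitive using (Star; ε; _◅_)
open import Relation.Binary.PropositionalEquality using (_≡_; _≢_; refl; sym; trans)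
open import Relation.Nullary using (¬_; Dec; yes; no; ¬?)
open import Relation.Nullary.Decidable using (map′; _×-dec_; decidable-stable)
import Relation.Unary as U
open import Relation.Unary using (Pred)

open Equivalence using (to; from)

-- Lists with a single element up to setoid equality

module _ (D : DecSetoid 0ℓ 0ℓ) where
  open DecSetoid D using (_≈_) renaming (refl to ≈-refl; sym to ≈-sym; trans to ≈-trans)
  open Unique D using (Unique)

  singleton-length : ∀ {xs y} → Unique xs → Any (y ≈_) xs →
                     (∀ {z} → Any (z ≈_) xs → z ≈ y) → length xs ≡ 1
  singleton-length {_ ∷ []} _ _ _ = refl
  singleton-length {_ ∷ _ ∷ _} ((a≉b ∷ _) ∷ _) _ ≈y =
    ⊥-elim (a≉b (≈-trans (≈y (here ≈-refl))
                         (≈-sym (≈y (there (here ≈-refl))))))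

  length-singleton : ∀ {xs} → length xs ≡ 1 →
                     ∃ λ y → Any (y ≈_) xs × (∀ {z} → Any (z ≈_) xs → z ≈ y)
  length-singleton {y ∷ []} refl = y , here ≈-refl , λ { (here z≈y) → z≈y }

-- Leaves, closed neighbourhoods and siblings in one graph

module _ (G : Graph) where
  open Graph G

  private
    neighbours : Vertex → List Vertex
    neighbours v = deduplicate _≈?_ (filter (adj? v) vertices)

    ∈-neighbours⁺ : ∀ {v z} → Adj v z → Any (z ≈_) (neighbours v)
    ∈-neighbours⁺ {v} {z} v~z =
      Membership.∈-deduplicate⁺ setoid _≈?_ (λ x≈y z≈x → ≈-trans z≈x (≈-sym x≈y))
        (Membership.∈-filter⁺ setoid (adj? v) (proj₁ adj-resp-≈) (enumeration z) v~z)

    ∈-neighbours⁻ : ∀ {v z} → Any (z ≈_) (neighbours v) → Adj v z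
    ∈-neighbours⁻ {v} z∈ =
      proj₂ (Membership.∈-filter⁻ setoid (adj? v) (proj₁ adj-resp-≈) {xs = vertices}
        (Membership.∈-deduplicate⁻ setoid _≈?_ _ z∈))

  leaf-neighbour : ∀ {v} → Leaf v → ∃ λ y → Adj v y × (∀ {z} → Adj v z → z ≈ y)
  leaf-neighbour l with length-singleton vertexSetoid l
  ... | y , y∈ , ≈y = y , ∈-neighbours⁻ y∈ , λ v~z → ≈y (∈-neighbours⁺ v~z)

  unique-neighbour⇒leaf : ∀ {v y} → Adj v y → (∀ {z} → Adj v z → z ≈ y) → Leaf v
  unique-neighbour⇒leaf v~y ≈y =
    singleton-length vertexSetoid (deduplicate-! vertexSetoid _) (∈-neighbours⁺ v~y)
      (λ z∈ → ≈y (∈-neighbours⁻ z∈))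

  leaf? : U.Decidable Leaf
  leaf? v = degree v ℕ.≟ 1

  leaf-resp : Leaf Respects _≈_
  leaf-resp u≈v l = trans (sym (degree-cong G u≈v)) l

  ∃? : ∀ {P : Pred Vertex 0ℓ} → U.Decidable P → P Respects _≈_ → Dec (∃ P)
  ∃? P? resp = map′ Any.satisfied
    (λ (v , p) → Any.map (λ v≈x → resp v≈x p) (enumeration v)) (Any.any? P? vertices)

  N-sym : ∀ {u v} → N[ v ] u → N[ u ] v
  N-sym (inj₁ u≈v) = inj₁ (≈-sym u≈v)
  N-sym (inj₂ v~u) = inj₂ (adj-sym v~u)

  N-respˡ : ∀ {u v w} → u ≈ₛ v → N[ u ] w → N[ v ] w
  N-respˡ u≈v = proj₁ u≈v

  N-respʳ : ∀ {u v w} → u ≈ₛ v → N[ w ] u → N[ w ] v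
  N-respʳ u≈v u∈ = N-sym (proj₁ u≈v (N-sym u∈))

  ≈ₛ-refl : ∀ {v} → v ≈ₛ v
  ≈ₛ-refl = (λ v∈ → v∈) , λ v∈ → v∈

  ≈ₛ-sym : ∀ {u v} → u ≈ₛ v → v ≈ₛ u
  ≈ₛ-sym (p , q) = q , p

  ≈ₛ-trans : ∀ {u v w} → u ≈ₛ v → v ≈ₛ w → u ≈ₛ w
  ≈ₛ-trans (p , q) (r , s) = (λ z∈ → r (p z∈)) , λ z∈ → q (s z∈)

  ≈ₛ⇒N : ∀ {u v} → u ≈ₛ v → N[ v ] u
  ≈ₛ⇒N u≈v = proj₁ u≈v (inj₁ ≈-refl)

  -- Adjacent siblings lose their edge in `ρ G` but become equal there, so closed neighbourhoods,
  -- unlike open ones, are unchanged.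
  N⇔N-ρ : ∀ {u v} → N[ v ] u ⇔ Graph.N[_] (ρ G) v u
  N⇔N-ρ {u} {v} = mk⇔ fwd λ { (inj₁ u≈v) → ≈ₛ⇒N u≈v ; (inj₂ (v~u , _)) → inj₂ v~u }
    where
    fwd : N[ v ] u → Graph.N[_] (ρ G) v u
    fwd (inj₁ u≈v) = inj₁ (≈⇒≈ₛ G u≈v)
    fwd (inj₂ v~u) with _≈ₛ?_ G v u
    ... | yes v≈u = inj₁ (≈ₛ-sym v≈u)
    ... | no  v≉u = inj₂ (v~u , v≉u)

  -- A path starting at `w` can only alternate between `w` and `n`, so by connectedness there are no
  -- other vertices.
  leaf-of-leaf⇒K₂ : Connected G → ∀ {w n} → Leaf w → Adj w n → Leaf n → G ≅ K 2
  leaf-of-leaf⇒K₂ (_ , path) {w} {n} leaf-w w~n leaf-n = record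
    { vertexInverse = record
        { to        = side
        ; from      = end
        ; to-cong   = λ u≈v → end-injective _ _
                        (≈-trans (≈-sym (end-side _)) (≈-trans u≈v (end-side _)))
        ; from-cong = λ { refl → ≈-refl }
        ; inverse   = (λ v≈end → end-injective _ _ (≈-trans (≈-sym (end-side _)) v≈end))
                    , λ { refl → ≈-sym (end-side _) }
        }
    ; adj-⇔ = λ u v → mk⇔
        (λ u~v s≡s → adj-irrefl (≈-trans (end-side u)
                       (≈-trans (end-cong s≡s) (≈-sym (end-side v)))) u~v)
        (λ s≢s → proj₁ adj-resp-≈ (≈-sym (end-side v))
                   (proj₂ adj-resp-≈ (≈-sym (end-side u)) (end-adj _ _ s≢s)))
    }
    where
    only : ∀ {u v} → Leaf u → Adj u v → ∀ {z} → Adj u z → z ≈ v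
    only l u~v u~z with leaf-neighbour l
    ... | _ , _ , ≈y = ≈-trans (≈y u~z) (≈-sym (≈y u~v))

    End : Pred Vertex 0ℓ
    End v = v ≈ w ⊎ v ≈ n

    follow : ∀ {u v} → Star _ u v → End u → End v
    follow ε e = e
    follow (inj₁ u≈x ◅ p) e = follow p
      ([ (λ u≈w → inj₁ (≈-trans (≈-sym u≈x) u≈w)) , (λ u≈n → inj₂ (≈-trans (≈-sym u≈x) u≈n)) ]′ e)
    follow (inj₂ u~x ◅ p) (inj₁ u≈w) =
      follow p (inj₂ (only leaf-w w~n (proj₂ adj-resp-≈ u≈w u~x)))
    follow (inj₂ u~x ◅ p) (inj₂ u≈n) =
      follow p (inj₁ (only leaf-n (adj-sym w~n) (proj₂ adj-resp-≈ u≈n u~x)))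

    isEnd : ∀ v → End v
    isEnd v = follow (path w v) (inj₁ ≈-refl)

    side : Vertex → Fin 2
    side v = [ (λ _ → zero) , (λ _ → suc zero) ]′ (isEnd v)

    end : Fin 2 → Vertex
    end zero       = w
    end (suc zero) = n

    end-cong : ∀ {i j} → i ≡ j → end i ≈ end j
    end-cong refl = ≈-refl

    end-side : ∀ v → v ≈ end (side v)
    end-side v with isEnd v
    ... | inj₁ v≈w = v≈w
    ... | inj₂ v≈n = v≈n

    end-adj : ∀ i j → i ≢ j → Adj (end i) (end j)
    end-adj zero       zero       i≢j = ⊥-elim (i≢j refl)
    end-adj zero       (suc zero) _   = w~n
    end-adj (suc zero) zero       _   = adj-sym w~n
    end-adj (suc zero) (suc zero) i≢j = ⊥-elim (i≢j refl)

    end-injective : ∀ i j → end i ≈ end j → i ≡ j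
    end-injective zero       zero       _   = refl
    end-injective zero       (suc zero) w≈n = ⊥-elim (adj-irrefl w≈n w~n)
    end-injective (suc zero) zero       n≈w = ⊥-elim (adj-irrefl n≈w (adj-sym w~n))
    end-injective (suc zero) (suc zero) _   = refl

-- Isomorphisms between sibling quotients

module _ {A B : Graph} where
  private
    module A = Graph A
    module B = Graph B

  -- Siblings are defined by closed neighbourhoods alone, so `f` is well defined and injective on
  -- classes; `g` then respects siblings because `f` reflects them. Adjacency in `ρ` is
  -- closed-neighbourhood membership between non-siblings.
  ρ-≅ : (f : A.Vertex → B.Vertex) → (∀ {u v} → A.N[ v ] u ⇔ B.N[ f v ] (f u)) →
        (g : B.Vertex → A.Vertex) → (∀ y → f (g y) B.≈ₛ y) → ρ A ≅ ρ B
  ρ-≅ f N⇔ g fg = record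
    { vertexInverse = record
        { to        = f
        ; from      = g
        ; to-cong   = f-cong
        ; from-cong = λ {x} {y} x≈y →
            f-reflects (≈ₛ-trans B (fg x) (≈ₛ-trans B x≈y (≈ₛ-sym B (fg y))))
        ; inverse   = (λ {y} {x} x≈gy → ≈ₛ-trans B (f-cong x≈gy) (fg y))
                    , (λ {x} {y} y≈fx → f-reflects (≈ₛ-trans B (fg y) y≈fx))
        }
    ; adj-⇔ = λ u v → mk⇔
        (λ (u~v , u≉v) → proper B (to N⇔ (inj₂ u~v)) (u≉v ∘ f-reflects))
        (λ (fu~fv , fu≉fv) → proper A (from N⇔ (inj₂ fu~fv)) (fu≉fv ∘ f-cong))
    }
    where
    half : ∀ {u v} → u A.≈ₛ v → ∀ {y} → B.N[ f u ] y → B.N[ f v ] y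
    half u≈v {y} y∈ =
      -- Replacing `y` by its sibling `f (g y)` allows membership to be pulled back to `A`.
      N-respʳ B (fg y) (to N⇔ (N-respˡ A u≈v (from N⇔ (N-respʳ B (≈ₛ-sym B (fg y)) y∈))))

    f-cong : ∀ {u v} → u A.≈ₛ v → f u B.≈ₛ f v
    f-cong u≈v = half u≈v , half (≈ₛ-sym A u≈v)

    f-reflects : ∀ {u v} → f u B.≈ₛ f v → u A.≈ₛ v
    f-reflects fu≈fv = (λ z∈ → from N⇔ (N-respˡ B fu≈fv (to N⇔ z∈)))
                     , (λ z∈ → from N⇔ (N-respˡ B (≈ₛ-sym B fu≈fv) (to N⇔ z∈)))

    proper : ∀ G {u v} → Graph.N[_] G u v → ¬ Graph._≈ₛ_ G u v → Graph.Adj (ρ G) u v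
    proper G (inj₁ v≈u) u≉v = ⊥-elim (u≉v (≈⇒≈ₛ G (Graph.≈-sym G v≈u)))
    proper G (inj₂ u~v) u≉v = u~v , u≉v

-- Surviving classes and the choice of `V`

module _ (G : Graph)
         (stem-not-leaf : ∀ {w n} → Graph.Leaf G w → Graph.Adj G w n → ¬ Graph.Leaf G n)
         (S : LeafSet G) where
  private
    module G = Graph G
    module S = LeafSet S
    G′ H : Graph
    G′ = λ-all G
    H  = λ-set G S
    module G′ = Graph G′
    module H  = Graph H

  ι : G′.Vertex → H.Vertex
  ι (v , ¬leaf) = v , λ m → ¬leaf (S.member⇒leaf m)

  ι-reflects-≈ₛ : ∀ {u v} → ι u H.≈ₛ ι v → u G′.≈ₛ v
  ι-reflects-≈ₛ (p , q) = (λ {z} → p {ι z}) , λ {z} → q {ι z}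

  Survives : Pred G′.Vertex 0ℓ
  Survives v = ¬ Graph.Leaf (ρ H) (ι v)

  -- In `H`, `w` has no neighbour but `a`. If `a` and `w` were siblings, the neighbour class `y` of
  -- `a` would meet `N[w]`, which is just `w` and `a`, and so be the class of `a`. Hence `w` lies in
  -- the class `y`, every neighbour of `a` is a sibling of `a` or of `w`, and `N[a]` equals `N[w]`
  -- after all, a contradiction.
  no-pendant : ∀ {a} → ¬ Survives a →
               ∀ (w : H.Vertex) → G.Leaf (proj₁ w) → ¬ G.Adj (proj₁ a) (proj₁ w)
  no-pendant {a} ¬surv w leaf-w a~w
    with leaf-neighbour (ρ H) {ι a} (decidable-stable (leaf? (ρ H) (ι a)) ¬surv)
  ... | y , (a~y , a≉y) , only = a≉w a≈w
    where
    N[w] : ∀ {z} → H.N[ w ] z → z H.≈ w ⊎ z H.≈ ι a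
    N[w] (inj₁ z≈w) = inj₁ z≈w
    N[w] (inj₂ w~z) with leaf-neighbour G leaf-w
    ... | _ , _ , ≈b = inj₂ (G.≈-trans (≈b w~z) (G.≈-sym (≈b (G.adj-sym a~w))))

    a≉w : ¬ ι a H.≈ₛ w
    a≉w a≈w with N[w] {y} (N-respˡ H {ι a} {w} {y} a≈w (inj₂ a~y))
    ... | inj₁ y≈w = a≉y (≈ₛ-trans H {ι a} {w} {y} a≈w (≈⇒≈ₛ H {w} {y} (G.≈-sym y≈w)))
    ... | inj₂ y≈a = a≉y (≈⇒≈ₛ H {ι a} {y} (G.≈-sym y≈a))

    w≈y : w H.≈ₛ y
    w≈y = only {w} (a~w , a≉w)

    a⊆w : ∀ {z} → H.N[ ι a ] z → H.N[ w ] z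
    a⊆w (inj₁ z≈a) = inj₂ (proj₁ G.adj-resp-≈ (G.≈-sym z≈a) (G.adj-sym a~w))
    a⊆w {z} (inj₂ a~z) with _≈ₛ?_ H (ι a) z
    ... | yes a≈z = N-sym H {w} {z} (N-respˡ H {ι a} {z} {w} a≈z (inj₂ a~w))
    ... | no  a≉z = ≈ₛ⇒N H {z} {w}
                      (≈ₛ-trans H {z} {y} {w} (only {z} (a~z , a≉z)) (≈ₛ-sym H {w} {y} w≈y))

    w⊆a : ∀ {z} → H.N[ w ] z → H.N[ ι a ] z
    w⊆a {z} z∈ with N[w] {z} z∈
    ... | inj₁ z≈w = inj₂ (proj₁ G.adj-resp-≈ (G.≈-sym z≈w) a~w)
    ... | inj₂ z≈a = inj₁ z≈a

    a≈w : ι a H.≈ₛ w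
    a≈w = (λ {z} → a⊆w {z}) , λ {z} → w⊆a {z}

  -- Only a leaf of `G` kept in `H` could separate siblings of `λ-all G`, and `no-pendant` excludes
  -- such a leaf next to `u` or `v`.
  ι-≈ₛ : ∀ {u v} → ¬ Survives u → ¬ Survives v → u G′.≈ₛ v → ι u H.≈ₛ ι v
  ι-≈ₛ {u} {v} ¬su ¬sv u≈v =
    (λ {z} → half u v ¬su u≈v z) , λ {z} → half v u ¬sv (≈ₛ-sym G′ {u} {v} u≈v) z
    where
    half : ∀ u v → ¬ Survives u → u G′.≈ₛ v → ∀ z → H.N[ ι u ] z → H.N[ ι v ] z
    half u v ¬su u≈v (z , k) z∈ with leaf? G z
    ... | no ¬leaf-z = proj₁ u≈v {z , ¬leaf-z} z∈
    half u v ¬su u≈v (z , k) (inj₁ z≈u) | yes leaf-z =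
      ⊥-elim (proj₂ u (leaf-resp G z≈u leaf-z))
    half u v ¬su u≈v (z , k) (inj₂ u~z) | yes leaf-z =
      ⊥-elim (no-pendant {u} ¬su (z , k) leaf-z u~z)

  -- Siblings in `G′` may fail to be siblings in `H`, so survival can differ within a class; the
  -- existential makes the condition one on classes.
  HasSurvivor : Pred G′.Vertex 0ℓ
  HasSurvivor c = ∃ λ c′ → c G′.≈ₛ c′ × Survives c′

  hasSurvivor? : U.Decidable HasSurvivor
  hasSurvivor? c = ∃? G′ (λ c′ → _≈ₛ?_ G′ c c′ ×-dec ¬? (leaf? (ρ H) (ι c′)))
                      (λ {x} {y} → resp {x} {y})
    where
    resp : (λ c′ → c G′.≈ₛ c′ × Survives c′) Respects G′._≈_
    resp {x} {y} x≈y (c≈x , s) =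
      ≈ₛ-trans G′ {c} {x} {y} c≈x (≈⇒≈ₛ G′ {x} {y} x≈y) ,
      λ l → s (leaf-resp (ρ H) {ι y} {ι x} (≈⇒≈ₛ H {ι y} {ι x} (G.≈-sym x≈y)) l)

  no-survivor⇒leaf : ∀ {c} → ¬ HasSurvivor c → Graph.Leaf (ρ G′) c
  no-survivor⇒leaf {c} none
    with leaf-neighbour (ρ H) {ι c}
           (decidable-stable (leaf? (ρ H) (ι c)) λ s → none (c , ≈ₛ-refl G′ {c} , s))
  ... | (y , k) , (c~y , c≉y) , only =
        unique-neighbour⇒leaf (ρ G′) {c} {y′}
          -- If `y′` were a sibling of `c` in `G′`, it would not survive either, and `ι-≈ₛ` would
          -- make the two siblings in `H`.
          (c~y , λ c≈y → c≉y (ι-≈ₛ {c} {y′} ¬sc (¬s {y′} c≈y) c≈y))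
          (λ {z} (c~z , c≉z) → ι-reflects-≈ₛ {z} {y′}
            (only {ι z} (c~z , λ c≈z → c≉z (ι-reflects-≈ₛ {c} {z} c≈z))))
    where
    ¬s : ∀ {c′} → c G′.≈ₛ c′ → ¬ Survives c′
    ¬s {c′} c≈c′ s = none (c′ , c≈c′ , s)

    ¬sc : ¬ Survives c
    ¬sc = ¬s {c} (≈ₛ-refl G′ {c})

    y′ : G′.Vertex
    y′ = y , λ leaf-y → no-pendant {c} ¬sc (y , k) leaf-y c~y

  V : LeafSet (ρ G′)
  V = record
    { Member      = λ c → ¬ HasSurvivor c
    ; member?     = λ c → ¬? (hasSurvivor? c)
    ; member-resp = λ {c} {d} c≈d none (c′ , d≈c′ , s) →
        none (c′ , ≈ₛ-trans G′ {c} {d} {c′} c≈d d≈c′ , s)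
    ; member⇒leaf = λ {c} → no-survivor⇒leaf {c}
    }

  -- The correspondence between `M` and `P`

  private
    M P : Graph
    M = λ-all (ρ H)
    P = λ-set (ρ G′) V
    module M = Graph M
    module P = Graph P

  core : (m : M.Vertex) → ∃ λ c → ι c H.≈ₛ proj₁ m
  core ((v , k) , ¬leaf) with leaf? G v
  ... | no ¬leaf-v = (v , ¬leaf-v) , ≈⇒≈ₛ H {ι (v , ¬leaf-v)} {v , k} G.≈-refl
  ... | yes leaf-v with leaf-neighbour G leaf-v
  ...   | n , v~n , ≈n = c , ≈ₛ-sym H {v , k} {ι c}
            -- Otherwise the class of `n` would be the only neighbour of `v` in `ρ H`, making `v` a
            -- leaf there, while `M` contains no leaf of `ρ H`.
            (decidable-stable (_≈ₛ?_ H (v , k) (ι c)) λ v≉c →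
              ¬leaf (unique-neighbour⇒leaf (ρ H) {v , k} {ι c} (v~n , v≉c)
                      (λ {z} (v~z , _) → ≈⇒≈ₛ H {z} {ι c} (≈n v~z))))
    where
    c : G′.Vertex
    c = n , stem-not-leaf leaf-v v~n

  toCore : M.Vertex → P.Vertex
  toCore m = proj₁ (core m) , λ none →
    -- The core is its own survivor: in `ρ H` it equals `m`, which is not a leaf.
    none (proj₁ (core m) , ≈ₛ-refl G′ {proj₁ (core m)} ,
          λ l → proj₂ m (leaf-resp (ρ H) {ι (proj₁ (core m))} {proj₁ m} (proj₂ (core m)) l))

  survivor : (y : P.Vertex) → HasSurvivor (proj₁ y)
  survivor (c , ¬none) = decidable-stable (hasSurvivor? c) ¬none

  -- The representative `y` itself may be a leaf of `ρ H`, so a surviving sibling is taken instead.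
  fromCore : P.Vertex → M.Vertex
  fromCore y = ι (proj₁ (survivor y)) , proj₂ (proj₂ (survivor y))

  -- `N⇔N-ρ` removes `ρ` on both sides. In `H` each vertex may be exchanged for its core, and
  -- between cores `H` and `G′` have the same adjacency, that of `G`.
  toCore-N : ∀ {u v} → M.N[ v ] u ⇔ P.N[ toCore v ] (toCore u)
  toCore-N {u} {v} = mk⇔
    (λ u∈ → to (N⇔N-ρ G′ {cu} {cv})
              (N-respˡ H {v₀} {ι cv} {ι cu} (≈ₛ-sym H {ι cv} {v₀} cv≈v)
                (N-respʳ H {u₀} {ι cu} {v₀} (≈ₛ-sym H {ι cu} {u₀} cu≈u)
                  (from (N⇔N-ρ H {u₀} {v₀}) u∈))))
    (λ cu∈ → to (N⇔N-ρ H {u₀} {v₀})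
               (N-respˡ H {ι cv} {v₀} {u₀} cv≈v
                 (N-respʳ H {ι cu} {u₀} {ι cv} cu≈u
                   (from (N⇔N-ρ G′ {cu} {cv}) cu∈))))
    where
    u₀ v₀ : H.Vertex
    u₀ = proj₁ u
    v₀ = proj₁ v

    cu cv : G′.Vertex
    cu = proj₁ (core u)
    cv = proj₁ (core v)

    cu≈u : ι cu H.≈ₛ u₀
    cu≈u = proj₂ (core u)

    cv≈v : ι cv H.≈ₛ v₀
    cv≈v = proj₂ (core v)

  toCore-fromCore : ∀ y → toCore (fromCore y) P.≈ₛ y
  toCore-fromCore y = ≈⇒≈ₛ P {toCore (fromCore y)} {y}
    -- The core of the survivor `c′` is its sibling in `H`, hence in `G′`, where `c′` is a sibling
    -- of `y`.
    (≈ₛ-trans G′ {d} {c′} {proj₁ y}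
      (ι-reflects-≈ₛ {d} {c′} (proj₂ (core (fromCore y))))
      (≈ₛ-sym G′ {proj₁ y} {c′} (proj₁ (proj₂ (survivor y)))))
    where
    c′ d : G′.Vertex
    c′ = proj₁ (survivor y)
    d  = proj₁ (core (fromCore y))

  ρλρλ-≅ : ρ M ≅ ρ P
  ρλρλ-≅ = ρ-≅ {M} {P} toCore (λ {u} {v} → toCore-N {u} {v}) fromCore toCore-fromCore

theorem5p1 : (G : Graph) → Connected G → ¬ (G ≅ K 2) → (U : LeafSet G) →
    Σ (LeafSet (ρ (λ-all G))) λ V →
    ρ (λ-all (ρ (λ-set G U))) ≅ ρ (λ-set (ρ (λ-all G)) V)
theorem5p1 G conn G≇K₂ U = V G stem-not-leaf U , ρλρλ-≅ G stem-not-leaf U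
  where
  -- Connectedness and the exclusion of `K 2` enter only through this fact.
  stem-not-leaf : ∀ {w n} → Graph.Leaf G w → Graph.Adj G w n → ¬ Graph.Leaf G n
  stem-not-leaf leaf-w w~n leaf-n = G≇K₂ (leaf-of-leaf⇒K₂ G conn leaf-w w~n leaf-n)
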